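{- Let $r\ge 2$, $t\ge 1$, $k\ge 2$ and $n$ be integers. If $G$ is a $K_k$-free blue-red graph on $n$ vertices, then $$\mathcal{N}(K_r,G_{blue})+t|E(G_{red})|+(t-1)\left(\binom{n}{2}-|E(G)|\right)\le (t-1)\binom{n}{2}+\max\{ex(n,K_r,K_k)-(t-1)ex(n,K_k),\ ex(n,K_k)\}.$$
   Context: A blue-red graph is a simple graph each of whose edges is colored blue or red; $G_{blue}$ and $G_{red}$ are the spanning subgraphs formed by the blue and the red edges, and $E(G)$ is the set of all edges. $\mathcal{N}(H,G)$ denotes the number of copies of $H$ in $G$. $ex(n,F)$ is the maximum number of edges of an $F$-free graph on $n$ vertices, and $ex(n,H,F)$ is the maximum of $\mathcal{N}(H,G)$ over $F$-free graphs $G$ on $n$ vertices. -}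

module Defs where

open import Data.Nat using (ℕ; zero; suc; _<ᵇ_)
open import Data.Bool using (Bool; true; false; _∧_; _∨_; not; if_then_else_)
open import Data.Fin using (Fin; toℕ; _≟_)
open import Data.Fin.Subset using (Subset; inside; outside; ∣_∣)
open import Data.Vec using (Vec; []; _∷_; lookup)
open import Data.List using (List; []; _∷_; [_]; map; _++_; length; filter; allFin; concatMap)
open import Data.Product using (Σ; _×_)
open import Relation.Nullary using (¬_)
open import Relation.Nullary.Decidable using (⌊_⌋)
open import Relation.Binary.PropositionalEquality using (_≡_; refl; cong; trans)
import Data.Nat as ℕ

record Graph (n : ℕ) : Set where
  field
    adj    : Fin n → Fin n → Bool
    sym    : ∀ i j → adj i j ≡ adj j i
    irrefl : ∀ i → adj i i ≡ false
open Graph public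

data Colour : Set where
  none blue red : Colour

record BRGraph (n : ℕ) : Set where
  field
    col    : Fin n → Fin n → Colour
    sym    : ∀ i j → col i j ≡ col j i
    irrefl : ∀ i → col i i ≡ none
open BRGraph public

isEdge isBlue isRed : Colour → Bool
isEdge none = false
isEdge _    = true
isBlue blue = true
isBlue _    = false
isRed red   = true
isRed _     = false

private
  spanning : ∀ {n} (f : Colour → Bool) (B : BRGraph n) → f none ≡ false → Graph n
  spanning f B p = record
    { adj = λ i j → f (col B i j)
    ; sym = λ i j → cong f (BRGraph.sym B i j)
    ; irrefl = λ i → trans (cong f (BRGraph.irrefl B i)) p }

underlying blueGraph redGraph : ∀ {n} → BRGraph n → Graph n
underlying B = spanning isEdge B refl
blueGraph  B = spanning isBlue B refl
redGraph   B = spanning isRed  B refl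

allSubsets : (n : ℕ) → List (Subset n)
allSubsets zero    = [ [] ]
allSubsets (suc n) = map (outside ∷_) (allSubsets n) ++ map (inside ∷_) (allSubsets n)

countᵇ : ∀ {A : Set} → (A → Bool) → List A → ℕ
countᵇ p []       = 0
countᵇ p (x ∷ xs) = if p x then suc (countᵇ p xs) else countᵇ p xs

allᵇ : ∀ {A : Set} → (A → Bool) → List A → Bool
allᵇ p []       = true
allᵇ p (x ∷ xs) = p x ∧ allᵇ p xs

isCliqueᵇ : ∀ {n} → Graph n → Subset n → Bool
isCliqueᵇ {n} G S =
  allᵇ (λ i → allᵇ (λ j → not (lookup S i ∧ lookup S j ∧ not ⌊ i ≟ j ⌋) ∨ adj G i j) (allFin n)) (allFin n)

copiesK : ∀ {n} → ℕ → Graph n → ℕ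
copiesK {n} r G = countᵇ (λ S → ⌊ ∣ S ∣ ℕ.≟ r ⌋ ∧ isCliqueᵇ G S) (allSubsets n)

edgeCount : ∀ {n} → Graph n → ℕ
edgeCount {n} G = countᵇ (λ b → b) pairs
  where
    pairs : List Bool
    pairs = concatMap (λ i → map (λ j → (toℕ i <ᵇ toℕ j) ∧ adj G i j) (allFin n)) (allFin n)

KFree : ∀ {n} → ℕ → Graph n → Set
KFree k G = copiesK k G ≡ 0

IsExCliques : (n r k m : ℕ) → Set
IsExCliques n r k m =
  (∀ (G : Graph n) → KFree k G → copiesK r G ℕ.≤ m) ×
  Σ (Graph n) (λ G → KFree k G × copiesK r G ≡ m)

IsExEdges : (n k m : ℕ) → Set
IsExEdges n k m =
  (∀ (G : Graph n) → KFree k G → edgeCount G ℕ.≤ m) ×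
  Σ (Graph n) (λ G → KFree k G × edgeCount G ≡ m)

{-# OPTIONS --safe #-}
module Submission where

-- Vertices carry weights, and cliques are counted with the product of their weights. The quantity
-- Φ = N(K_r, blue) - t |blue| + |E|, which is the left-hand side up to (t - 1) C(n, 2), is affine in
-- the weight of each vertex and has no cross term for two non-adjacent vertices, so the weight of
-- one of them can be moved to the other without decreasing Φ (Zykov symmetrization). Hence one may
-- assume that the support is a clique, with fewer than k vertices and weights w. On it the same
-- merging, applied to pairs that are not blue, together with e_(a+b) ≤ e_a e_b for elementary
-- symmetric polynomials, shows that N(K_r, blue) - t |blue| ≤ max(0, e_r(w) - t e_2(w)). So
-- Φ ≤ max(e_2(w), e_r(w) - (t - 1) e_2(w)). Finally, balancing w to the part sizes T of the Turán
-- graph does not decrease e_2, nor e_r - (t - 1) e_2 unless the latter was not positive in the first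
-- place; with t = 1 and r = 2 the bound is Turán's theorem ex(n, K_k) = e_2(T).

open import Defs
open import Data.Nat using (ℕ; _≤_)
open import Data.Nat.Combinatorics using (_C_)
open import Data.Integer using (ℤ; +_; _+_; _-_; _*_; _⊔_) renaming (_≤_ to _≤ℤ_)

import Data.Nat as ℕ
import Data.Integer as ℤ
import Data.Nat.Properties as ℕₚ
import Data.Integer.Properties as ℤₚ
open import Data.Nat using (zero; suc; _∸_; _<ᵇ_; _≡ᵇ_; z≤n; s≤s)
open import Data.Nat.DivMod using (_/_; _%_; [m+kn]%n≡m%n; m<n⇒m%n≡m; m<n⇒m/n≡0; m*n/n≡m; +-distrib-/-∣ʳ)
open import Data.Nat.Divisibility using (divides)
open import Data.Bool using (Bool; true; false; not; _∧_; _∨_)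
open import Data.Bool.Properties as Boolₚ using (∧-comm; T-≡; ⇔→≡)
open import Data.Fin as Fin using (Fin; zero; suc; toℕ)
open import Data.Fin.Subset using (Subset; ∣_∣)
import Data.Vec as Vec
open import Data.Vec using ([]; _∷_)
open import Data.List
  using (List; []; _∷_; map; _++_; length; filterᵇ; replicate; tabulate; lookup; allFin; concatMap)
open import Data.List.Properties
  using (filter-all; length-++; length-replicate; map-tabulate; tabulate-cong; tabulate-lookup)
open import Data.List.Relation.Unary.All as All using (All; []; _∷_)
open import Data.List.Relation.Unary.AllPairs using (AllPairs; []; _∷_)
open import Data.List.Relation.Binary.Permutation.Propositional
  using (_↭_; prep; swap; ↭-refl; ↭-sym; ↭-trans)
import Data.List.Relation.Binary.Permutation.Propositional as Perm
open import Data.List.Relation.Binary.Permutation.Propositional.Properties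
  using (filter-↭; shift; map⁺; ↭-length; All-resp-↭)
open import Data.Nat.ListAction using (sum)
open import Data.Nat.ListAction.Properties using (sum-↭; sum-++)
open import Data.Product using (Σ; ∃; _×_; _,_; proj₁; proj₂)
open import Data.Sum using (_⊎_; inj₁; inj₂)
open import Function using (_∘_)
open import Function.Bundles using (Equivalence; _⇔_; mk⇔)
open import Relation.Nullary using (¬_; Dec; yes; no; contradiction)
open import Relation.Nullary.Decidable using (T?; ⌊_⌋; isYes≗does)
open import Relation.Binary.PropositionalEquality
  using (_≡_; _≢_; refl; cong; cong₂; trans; subst; module ≡-Reasoning) renaming (sym to ≡-sym)
import Data.Nat.Tactic.RingSolver as ℕ-Ring
import Data.Integer.Tactic.RingSolver as ℤ-Ring

-- A permutation brings the failing element to the front, because merging and balancing act on the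
-- first entries of a list.
findCounterexample : ∀ {A : Set} {P : A → Set} → (∀ x → Dec (P x)) → ∀ xs →
  All P xs ⊎ ∃ λ x → ∃ λ ys → xs ↭ (x ∷ ys) × ¬ P x
findCounterexample P? [] = inj₁ []
findCounterexample P? (x ∷ xs) with P? x | findCounterexample P? xs
... | no ¬p | _      = inj₂ (x , xs , ↭-refl , ¬p)
... | yes p | inj₁ q = inj₁ (p ∷ q)
... | yes p | inj₂ (y , ys , q , ¬r) = inj₂ (y , x ∷ ys , ↭-trans (prep x q) (swap x y ↭-refl) , ¬r)

-- Elementary symmetric polynomials

esym : ℕ → List ℕ → ℕ
esym zero    xs       = 1
esym (suc r) []       = 0
esym (suc r) (x ∷ xs) = esym (suc r) xs ℕ.+ x ℕ.* esym r xs

esym-↭ : ∀ r {xs ys} → xs ↭ ys → esym r xs ≡ esym r ys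
esym-↭ zero    p            = refl
esym-↭ (suc r) Perm.refl    = refl
esym-↭ (suc r) (prep x p)   = cong₂ (λ e f → e ℕ.+ x ℕ.* f) (esym-↭ (suc r) p) (esym-↭ r p)
esym-↭ (suc zero) (swap x y p) rewrite esym-↭ 1 p = lemma _ x y
  where
  lemma : ∀ e x y → e ℕ.+ y ℕ.* 1 ℕ.+ x ℕ.* 1 ≡ e ℕ.+ x ℕ.* 1 ℕ.+ y ℕ.* 1
  lemma = ℕ-Ring.solve-∀
esym-↭ (suc (suc r)) (swap x y p)
  rewrite esym-↭ (suc (suc r)) p | esym-↭ (suc r) p | esym-↭ r p = lemma _ _ _ x y
  where
  lemma : ∀ e f g x y → e ℕ.+ y ℕ.* f ℕ.+ x ℕ.* (f ℕ.+ y ℕ.* g) ≡ e ℕ.+ x ℕ.* f ℕ.+ y ℕ.* (f ℕ.+ x ℕ.* g)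
  lemma = ℕ-Ring.solve-∀
esym-↭ (suc r) (Perm.trans p q) = trans (esym-↭ (suc r) p) (esym-↭ (suc r) q)

-- Cutting a monomial of degree `a + b` after its first `a` variables, in list order, is injective,
-- and the resulting pairs are among the terms of the product.
esym-submult : ∀ a b xs → esym (a ℕ.+ b) xs ≤ esym a xs ℕ.* esym b xs
esym-submult zero    b xs = ℕₚ.≤-reflexive (≡-sym (ℕₚ.+-identityʳ _))
esym-submult (suc a) b [] = z≤n
esym-submult (suc a) b (x ∷ xs) = begin
  esym (suc a ℕ.+ b) xs ℕ.+ x ℕ.* esym (a ℕ.+ b) xs
    ≤⟨ ℕₚ.+-mono-≤ (esym-submult (suc a) b xs) (ℕₚ.*-monoʳ-≤ x (esym-submult a b xs)) ⟩
  esym (suc a) xs ℕ.* esym b xs ℕ.+ x ℕ.* (esym a xs ℕ.* esym b xs)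
    ≡⟨ lemma (esym (suc a) xs) (esym a xs) (esym b xs) x ⟩
  esym (suc a) (x ∷ xs) ℕ.* esym b xs
    ≤⟨ ℕₚ.*-monoʳ-≤ (esym (suc a) (x ∷ xs)) (esym-grow b) ⟩
  esym (suc a) (x ∷ xs) ℕ.* esym b (x ∷ xs) ∎
  where
  open ℕₚ.≤-Reasoning
  lemma : ∀ e f g x → e ℕ.* g ℕ.+ x ℕ.* (f ℕ.* g) ≡ (e ℕ.+ x ℕ.* f) ℕ.* g
  lemma = ℕ-Ring.solve-∀
  esym-grow : ∀ b → esym b xs ≤ esym b (x ∷ xs)
  esym-grow zero    = ℕₚ.≤-refl
  esym-grow (suc b) = ℕₚ.m≤m+n _ _

-- Replacing `x` and `y` by their sum loses exactly the monomials that contain both.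
esym-pair : ∀ r x y zs →
  esym (suc (suc r)) (x ∷ y ∷ zs) ≡ esym (suc (suc r)) (x ℕ.+ y ∷ zs) ℕ.+ x ℕ.* y ℕ.* esym r zs
esym-pair r x y zs = lemma (esym (suc (suc r)) zs) (esym (suc r) zs) (esym r zs) x y
  where
  lemma : ∀ e f g x y → e ℕ.+ y ℕ.* f ℕ.+ x ℕ.* (f ℕ.+ y ℕ.* g) ≡ e ℕ.+ (x ℕ.+ y) ℕ.* f ℕ.+ x ℕ.* y ℕ.* g
  lemma = ℕ-Ring.solve-∀

-- Split two variables off each monomial, `x` among them if it occurs; the rest lies in `zs`. The
-- factor `esym r zs` is the coefficient in `esym-pair`, so one threshold will serve both.
esym-bound₁ : ∀ r x zs → esym (suc (suc r)) (x ∷ zs) ≤ esym r zs ℕ.* esym 2 (x ∷ zs)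
esym-bound₁ r x zs = begin
  esym (2 ℕ.+ r) zs ℕ.+ x ℕ.* esym (1 ℕ.+ r) zs
    ≤⟨ ℕₚ.+-mono-≤ (esym-submult 2 r zs) (ℕₚ.*-monoʳ-≤ x (esym-submult 1 r zs)) ⟩
  esym 2 zs ℕ.* esym r zs ℕ.+ x ℕ.* (esym 1 zs ℕ.* esym r zs)
    ≡⟨ lemma (esym 2 zs) (esym 1 zs) (esym r zs) x ⟩
  esym r zs ℕ.* esym 2 (x ∷ zs) ∎
  where
  open ℕₚ.≤-Reasoning
  lemma : ∀ e f g x → e ℕ.* g ℕ.+ x ℕ.* (f ℕ.* g) ≡ g ℕ.* (e ℕ.+ x ℕ.* f)
  lemma = ℕ-Ring.solve-∀

-- The monomials with both `x` and `y` sum to `x * y * esym r zs`; the others are covered by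
-- `esym-bound₁` at `x + y`.
esym-bound₂ : ∀ r x y zs → esym (suc (suc r)) (x ∷ y ∷ zs) ≤ esym r zs ℕ.* esym 2 (x ∷ y ∷ zs)
esym-bound₂ r x y zs = begin
  esym (suc (suc r)) (x ∷ y ∷ zs)
    ≡⟨ esym-pair r x y zs ⟩
  esym (suc (suc r)) (x ℕ.+ y ∷ zs) ℕ.+ x ℕ.* y ℕ.* esym r zs
    ≤⟨ ℕₚ.+-monoˡ-≤ _ (esym-bound₁ r (x ℕ.+ y) zs) ⟩
  esym r zs ℕ.* esym 2 (x ℕ.+ y ∷ zs) ℕ.+ x ℕ.* y ℕ.* esym r zs
    ≡⟨ lemma (esym r zs) (esym 2 (x ℕ.+ y ∷ zs)) (x ℕ.* y) ⟩
  esym r zs ℕ.* (esym 2 (x ℕ.+ y ∷ zs) ℕ.+ x ℕ.* y ℕ.* 1)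
    ≡⟨ cong (esym r zs ℕ.*_) (esym-pair 0 x y zs) ⟨
  esym r zs ℕ.* esym 2 (x ∷ y ∷ zs) ∎
  where
  open ℕₚ.≤-Reasoning
  lemma : ∀ g e p → g ℕ.* e ℕ.+ p ℕ.* g ≡ g ℕ.* (e ℕ.+ p ℕ.* 1)
  lemma = ℕ-Ring.solve-∀

esym-positive : ∀ r {xs} → All (1 ≤_) xs → r ≤ length xs → 1 ≤ esym r xs
esym-positive zero    p       l       = ℕₚ.≤-refl
esym-positive (suc r) {x ∷ xs} (q ∷ p) (s≤s l) =
  ℕₚ.≤-trans (ℕₚ.*-mono-≤ q (esym-positive r p l)) (ℕₚ.m≤n+m _ (esym (suc r) xs))

esym-vanishes : ∀ r xs → length xs ℕ.< r → esym r xs ≡ 0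
esym-vanishes (suc r) []       l       = refl
esym-vanishes (suc r) (x ∷ xs) (s≤s l)
  rewrite esym-vanishes r xs l | esym-vanishes (suc r) xs (ℕₚ.m≤n⇒m≤1+n l) = ℕₚ.*-zeroʳ x

esym-zeros : ∀ r j xs → esym r (replicate j 0 ++ xs) ≡ esym r xs
esym-zeros zero    j       xs = refl
esym-zeros (suc r) zero    xs = refl
esym-zeros (suc r) (suc j) xs = trans (ℕₚ.+-identityʳ _) (esym-zeros (suc r) j xs)

-- Weighted clique counts

filterᵇ-filterᵇ : ∀ {A : Set} (p q : A → Bool) xs →
  filterᵇ p (filterᵇ q xs) ≡ filterᵇ (λ x → q x ∧ p x) xs
filterᵇ-filterᵇ p q [] = refl
filterᵇ-filterᵇ p q (x ∷ xs) with q x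
... | false = filterᵇ-filterᵇ p q xs
... | true with p x
...   | false = filterᵇ-filterᵇ p q xs
...   | true  = cong (x ∷_) (filterᵇ-filterᵇ p q xs)

filterᵇ-cong : ∀ {A : Set} {p q : A → Bool} → (∀ x → p x ≡ q x) → ∀ xs → filterᵇ p xs ≡ filterᵇ q xs
filterᵇ-cong e [] = refl
filterᵇ-cong {q = q} e (x ∷ xs) rewrite e x with q x
... | false = filterᵇ-cong e xs
... | true  = cong (x ∷_) (filterᵇ-cong e xs)

module _ {V : Set} where

  Weighted : Set
  Weighted = List (V × ℕ)

  weights : Weighted → List ℕ
  weights = map proj₂

  nbrs : (V → V → Bool) → V → Weighted → Weighted
  nbrs a u = filterᵇ (a u ∘ proj₁)

  -- Each clique counts with the product of the weights of its vertices, i.e. this is the number of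
  -- r-cliques of the blow-up in which a vertex of weight x becomes x independent copies.
  cliques : (V → V → Bool) → ℕ → Weighted → ℕ
  cliques a zero    L             = 1
  cliques a (suc r) []            = 0
  cliques a (suc r) ((v , x) ∷ L) = cliques a (suc r) L ℕ.+ x ℕ.* cliques a r (nbrs a v L)

  nbrs-comm : ∀ a u v L → nbrs a u (nbrs a v L) ≡ nbrs a v (nbrs a u L)
  nbrs-comm a u v L = trans (filterᵇ-filterᵇ _ _ L)
    (trans (filterᵇ-cong (λ e → ∧-comm (a v (proj₁ e)) (a u (proj₁ e))) L)
           (≡-sym (filterᵇ-filterᵇ _ _ L)))

  -- The recursion reads each pair in list order only; symmetry of `a` makes the count independent
  -- of that order.
  module _ {a : V → V → Bool} (a-sym : ∀ u v → a u v ≡ a v u) where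

    cliques-swap : ∀ r p q L → cliques a r (p ∷ q ∷ L) ≡ cliques a r (q ∷ p ∷ L)
    cliques-swap zero p q L = refl
    cliques-swap (suc zero) (u , x) (v , y) L = lemma _ x y
      where
      lemma : ∀ e x y → e ℕ.+ y ℕ.* 1 ℕ.+ x ℕ.* 1 ≡ e ℕ.+ x ℕ.* 1 ℕ.+ y ℕ.* 1
      lemma = ℕ-Ring.solve-∀
    cliques-swap (suc (suc r)) (u , x) (v , y) L rewrite a-sym v u with a u v
    ... | false = lemma (cliques a (suc (suc r)) L) _ _
      where
      lemma : ∀ e f g → e ℕ.+ f ℕ.+ g ≡ e ℕ.+ g ℕ.+ f
      lemma = ℕ-Ring.solve-∀
    ... | true rewrite nbrs-comm a u v L =
      lemma (cliques a (suc (suc r)) L) (cliques a (suc r) (nbrs a v L)) (cliques a (suc r) (nbrs a u L)) _ x y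
      where
      lemma : ∀ e f g h x y →
        e ℕ.+ y ℕ.* f ℕ.+ x ℕ.* (g ℕ.+ y ℕ.* h) ≡ e ℕ.+ x ℕ.* g ℕ.+ y ℕ.* (f ℕ.+ x ℕ.* h)
      lemma = ℕ-Ring.solve-∀

    cliques-↭ : ∀ r {L M} → L ↭ M → cliques a r L ≡ cliques a r M
    cliques-↭ zero    p = refl
    cliques-↭ (suc r) Perm.refl = refl
    cliques-↭ (suc r) (prep (u , x) p) = cong₂ (λ e f → e ℕ.+ x ℕ.* f)
      (cliques-↭ (suc r) p) (cliques-↭ r (filter-↭ (λ e → T? (a u (proj₁ e))) p))
    cliques-↭ (suc r) {M = _ ∷ _ ∷ M} (swap (u , x) (v , y) p) = trans
      (cong₂ (λ e f → e ℕ.+ x ℕ.* f)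
        (cong₂ (λ e f → e ℕ.+ y ℕ.* f)
          (cliques-↭ (suc r) p) (cliques-↭ r (filter-↭ (λ e → T? (a v (proj₁ e))) p)))
        (cliques-↭ r (filter-↭ (λ e → T? (a u (proj₁ e))) (prep (v , y) p))))
      (cliques-swap (suc r) (u , x) (v , y) M)
    cliques-↭ (suc r) (Perm.trans p q) = trans (cliques-↭ (suc r) p) (cliques-↭ (suc r) q)

  Complete : (V → V → Bool) → Weighted → Set
  Complete a = AllPairs (λ p q → a (proj₁ p) (proj₁ q) ≡ true)

  -- In a clique, passing to neighbours discards nothing, so the recursion becomes that of `esym`.
  cliques-complete : ∀ {a} r {L} → Complete a L → cliques a r L ≡ esym r (weights L)
  cliques-complete zero    c  = refl
  cliques-complete (suc r) [] = refl
  cliques-complete {a} (suc r) {(u , x) ∷ L} (p ∷ c) rewrite filter-all (λ e → T? (a u (proj₁ e))) (All.map (Equivalence.from T-≡) p) =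
    cong₂ (λ e f → e ℕ.+ x ℕ.* f) (cliques-complete (suc r) c) (cliques-complete r c)

  -- Merging the weights of two non-adjacent vertices onto one of them removes a vertex, so a
  -- property stable under such merges only has to be checked on cliques.
  module _ (a : V → V → Bool) where

    findNonEdge : (L : Weighted) → Complete a L ⊎
      ∃ λ u → ∃ λ x → ∃ λ v → ∃ λ y → ∃ λ M → L ↭ ((u , x) ∷ (v , y) ∷ M) × a u v ≡ false
    findNonEdge [] = inj₁ []
    findNonEdge ((u , x) ∷ L) with findCounterexample (λ e → a u (proj₁ e) Boolₚ.≟ true) L | findNonEdge L
    ... | inj₂ ((v , y) , M , q , e) | _ = inj₂ (u , x , v , y , M , prep _ q , Boolₚ.¬-not e)
    ... | inj₁ p | inj₁ c = inj₁ (p ∷ c)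
    ... | inj₁ p | inj₂ (v , y , w , z , M , q , e) =
      inj₂ (v , y , w , z , (u , x) ∷ M ,
        ↭-trans (prep _ q) (↭-trans (swap _ _ ↭-refl) (prep _ (swap _ _ ↭-refl))) , e)

    mergeInduction : (Q : Weighted → Set) →
      (∀ L → Complete a L → Q L) →
      (∀ {L M} → L ↭ M → Q L → Q M) →
      (∀ u x v y L → a u v ≡ false →
        Q ((u , x ℕ.+ y) ∷ L) → Q ((v , x ℕ.+ y) ∷ L) → Q ((u , x) ∷ (v , y) ∷ L)) →
      ∀ L → Q L
    mergeInduction Q base resp step L = go (length L) L refl
      where
      -- Recursion on the length, since a merged list is shorter but not a structural part of `L`.
      go : ∀ ℓ L → length L ≡ ℓ → Q L
      go ℓ L eq with findNonEdge L
      go ℓ L eq | inj₁ c = base L c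
      go zero [] eq | inj₂ (u , x , v , y , M , q , e) with () ← ↭-length q
      go (suc ℓ) L eq | inj₂ (u , x , v , y , M , q , e) =
        resp (↭-sym q) (step u x v y M e (go ℓ _ shorter) (go ℓ _ shorter))
        where
        shorter : suc (length M) ≡ ℓ
        shorter = ℕₚ.suc-injective (trans (≡-sym (↭-length q)) eq)

  collect : ∀ e s x y → e + y * s + x * s ≡ e + (x + y) * s
  collect = ℤ-Ring.solve-∀

  -- The hypothesis on `σ` excludes a cross term, so the value is `Φ L + x * σ u L + y * σ v L`, and
  -- all weight can go to the vertex with the larger slope.
  merge-affine : (Φ : Weighted → ℤ) (σ : V → Weighted → ℤ) →
    (∀ u x L → Φ ((u , x) ∷ L) ≡ Φ L + + x * σ u L) →
    ∀ u x v y L → σ u ((v , y) ∷ L) ≡ σ u L →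
    Φ ((u , x) ∷ (v , y) ∷ L) ≤ℤ Φ ((u , x ℕ.+ y) ∷ L) ⊎
    Φ ((u , x) ∷ (v , y) ∷ L) ≤ℤ Φ ((v , x ℕ.+ y) ∷ L)
  merge-affine Φ σ affine u x v y L eq
    rewrite affine u x ((v , y) ∷ L) | affine v y L | affine u (x ℕ.+ y) L | affine v (x ℕ.+ y) L
          | eq | ℤₚ.pos-+ x y
    with ℤₚ.≤-total (σ u L) (σ v L)
  ... | inj₁ u≤v = inj₂ (begin
    Φ L + + y * σ v L + + x * σ u L  ≤⟨ ℤₚ.+-monoʳ-≤ (Φ L + + y * σ v L) (ℤₚ.*-monoˡ-≤-nonNeg (+ x) u≤v) ⟩
    Φ L + + y * σ v L + + x * σ v L  ≡⟨ collect (Φ L) (σ v L) (+ x) (+ y) ⟩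
    Φ L + (+ x + + y) * σ v L        ∎)
    where open ℤₚ.≤-Reasoning
  ... | inj₂ v≤u = inj₁ (begin
    Φ L + + y * σ v L + + x * σ u L
      ≤⟨ ℤₚ.+-monoˡ-≤ _ (ℤₚ.+-monoʳ-≤ (Φ L) (ℤₚ.*-monoˡ-≤-nonNeg (+ y) v≤u)) ⟩
    Φ L + + y * σ u L + + x * σ u L  ≡⟨ collect (Φ L) (σ u L) (+ x) (+ y) ⟩
    Φ L + (+ x + + y) * σ u L        ∎)
    where open ℤₚ.≤-Reasoning

-- The weight trade-off between r-cliques and edges

-- In the complete multipartite graph with part sizes `xs`, this is the number of copies of K_(r+2)
-- minus `c` times the number of edges.
gain : ℕ → ℕ → List ℕ → ℤ
gain r c xs = + esym (suc (suc r)) xs - + c * + esym 2 xs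

gain-↭ : ∀ r c {xs ys} → xs ↭ ys → gain r c xs ≡ gain r c ys
gain-↭ r c p = cong₂ (λ e f → + e - + c * + f) (esym-↭ (suc (suc r)) p) (esym-↭ 2 p)

pos-+* : ∀ e p g → + (e ℕ.+ p ℕ.* g) ≡ + e + + p * + g
pos-+* e p g = trans (ℤₚ.pos-+ e (p ℕ.* g)) (cong (λ z → + e + z) (ℤₚ.pos-* p g))

-- With `x + y` fixed, only the product `x * y` matters, and the sign of `esym r zs - c` decides
-- whether a larger product helps.
gain-pair : ∀ r c x y zs →
  gain r c (x ∷ y ∷ zs) ≡ gain r c (x ℕ.+ y ∷ zs) + + (x ℕ.* y) * (+ esym r zs - + c)
gain-pair r c x y zs = trans
  (cong₂ (λ e f → e - + c * f)
    (trans (cong (λ k → + k) (esym-pair r x y zs)) (pos-+* (esym (suc (suc r)) (x ℕ.+ y ∷ zs)) (x ℕ.* y) (esym r zs)))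
    (trans (cong (λ k → + k) (esym-pair 0 x y zs)) (pos-+* (esym 2 (x ℕ.+ y ∷ zs)) (x ℕ.* y) 1)))
  (lemma (+ esym (suc (suc r)) (x ℕ.+ y ∷ zs)) (+ esym 2 (x ℕ.+ y ∷ zs)) (+ (x ℕ.* y)) (+ esym r zs) (+ c))
  where
  lemma : ∀ e f p g c → e + p * g - c * (f + p * + 1) ≡ e - c * f + p * (g - c)
  lemma = ℤ-Ring.solve-∀

gain-nonPositive : ∀ r c {d} xs → esym (suc (suc r)) xs ≤ d ℕ.* esym 2 xs → d ≤ c → gain r c xs ≤ℤ + 0
gain-nonPositive r c xs le d≤c = ℤₚ.i≤j⇒i-j≤0
  (subst (+ esym (suc (suc r)) xs ≤ℤ_) (ℤₚ.pos-* c (esym 2 xs))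
    (ℤ.+≤+ (ℕₚ.≤-trans le (ℕₚ.*-monoˡ-≤ (esym 2 xs) d≤c))))

-- If `esym r zs` is at most `c`, then `esym-bound₁` makes the left side non-positive; otherwise
-- splitting adds a non-negative term.
gain-split : ∀ r c x y zs →
  gain r c (x ℕ.+ y ∷ zs) ≤ℤ + 0 ⊎ gain r c (x ℕ.+ y ∷ zs) ≤ℤ gain r c (x ∷ y ∷ zs)
gain-split r c x y zs with ℕₚ.≤-total (esym r zs) c
... | inj₁ e≤c = inj₁ (gain-nonPositive r c (x ℕ.+ y ∷ zs) (esym-bound₁ r (x ℕ.+ y) zs) e≤c)
... | inj₂ c≤e = inj₂ (subst (gain r c (x ℕ.+ y ∷ zs) ≤ℤ_) (≡-sym (gain-pair r c x y zs))
  (subst (_≤ℤ gain r c (x ℕ.+ y ∷ zs) + + (x ℕ.* y) * (+ esym r zs - + c)) (ℤₚ.+-identityʳ _)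
    (ℤₚ.+-monoʳ-≤ (gain r c (x ℕ.+ y ∷ zs))
      (subst (_≤ℤ + (x ℕ.* y) * (+ esym r zs - + c)) (ℤₚ.*-zeroʳ (+ (x ℕ.* y)))
        (ℤₚ.*-monoˡ-≤-nonNeg (+ (x ℕ.* y)) (ℤₚ.i≤j⇒0≤j-i (ℤ.+≤+ c≤e)))))))

-- The same trade-off in a weighted graph

module _ {V : Set} (b : V → V → Bool) where

  net : ℕ → ℕ → Weighted → ℤ
  net r c L = + cliques b (suc (suc r)) L - + c * + cliques b 2 L

  net-slope : ℕ → ℕ → V → Weighted → ℤ
  net-slope r c u L = + cliques b (suc r) (nbrs b u L) - + c * + cliques b 1 (nbrs b u L)

  net-affine : ∀ r c u x L → net r c ((u , x) ∷ L) ≡ net r c L + + x * net-slope r c u L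
  net-affine r c u x L = trans
    (cong₂ (λ e f → e - + c * f)
      (pos-+* (cliques b (suc (suc r)) L) x (cliques b (suc r) (nbrs b u L)))
      (pos-+* (cliques b 2 L) x (cliques b 1 (nbrs b u L))))
    (lemma (+ cliques b (suc (suc r)) L) (+ cliques b (suc r) (nbrs b u L))
           (+ cliques b 2 L) (+ cliques b 1 (nbrs b u L)) (+ x) (+ c))
    where
    lemma : ∀ e f g h x c → e + x * f - c * (g + x * h) ≡ e - c * g + x * (f - c * h)
    lemma = ℤ-Ring.solve-∀

  nbrs-nonadjacent : ∀ {u v} y L → b u v ≡ false → nbrs b u ((v , y) ∷ L) ≡ nbrs b u L
  nbrs-nonadjacent y L e rewrite e = refl

module _ {V : Set} {b : V → V → Bool} (b-sym : ∀ u v → b u v ≡ b v u) where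

  net-↭ : ∀ r c {L M} → L ↭ M → net b r c L ≡ net b r c M
  net-↭ r c p = cong₂ (λ e f → + e - + c * + f) (cliques-↭ b-sym (suc (suc r)) p) (cliques-↭ b-sym 2 p)

  -- Merging a pair not joined in `b` does not decrease `net` but shortens the weight list.
  -- `gain-split` undoes this on the right, so the bound refers to the original weights.
  net-bound : ∀ r c L → net b r c L ≤ℤ + 0 ⊎ net b r c L ≤ℤ gain r c (weights L)
  net-bound r c = mergeInduction b Q base resp step
    where
    Q : Weighted → Set
    Q L = net b r c L ≤ℤ + 0 ⊎ net b r c L ≤ℤ gain r c (weights L)

    base : ∀ L → Complete b L → Q L
    base L p = inj₂ (ℤₚ.≤-reflexive (cong₂ (λ e f → + e - + c * + f)
      (cliques-complete (suc (suc r)) p) (cliques-complete 2 p)))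

    resp : ∀ {L M} → L ↭ M → Q L → Q M
    resp p q rewrite net-↭ r c p | gain-↭ r c (map⁺ proj₂ p) = q

    extend : ∀ {m} x y zs → m ≤ℤ + 0 ⊎ m ≤ℤ gain r c (x ℕ.+ y ∷ zs) →
      m ≤ℤ + 0 ⊎ m ≤ℤ gain r c (x ∷ y ∷ zs)
    extend x y zs (inj₁ q) = inj₁ q
    extend x y zs (inj₂ q) with gain-split r c x y zs
    ... | inj₁ p = inj₁ (ℤₚ.≤-trans q p)
    ... | inj₂ p = inj₂ (ℤₚ.≤-trans q p)

    weaken : ∀ {m m′ g} → m ≤ℤ m′ → m′ ≤ℤ + 0 ⊎ m′ ≤ℤ g → m ≤ℤ + 0 ⊎ m ≤ℤ g
    weaken p (inj₁ q) = inj₁ (ℤₚ.≤-trans p q)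
    weaken p (inj₂ q) = inj₂ (ℤₚ.≤-trans p q)

    step : ∀ u x v y L → b u v ≡ false →
      Q ((u , x ℕ.+ y) ∷ L) → Q ((v , x ℕ.+ y) ∷ L) → Q ((u , x) ∷ (v , y) ∷ L)
    step u x v y L e qu qv
      with merge-affine (net b r c) (net-slope b r c) (net-affine b r c) u x v y L
             (cong (λ N → + cliques b (suc r) N - + c * + cliques b 1 N) (nbrs-nonadjacent b y L e))
    ... | inj₁ p = extend x y (weights L) (weaken p qu)
    ... | inj₂ p = extend x y (weights L) (weaken p qv)

-- Balancing

-- The part sizes of the Turán graph on n vertices with m + 1 parts.
equiparts : ℕ → ℕ → List ℕ
equiparts m n = replicate (suc m ∸ n % suc m) (n / suc m) ++ replicate (n % suc m) (suc (n / suc m))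

sum-replicate : ∀ m x → sum (replicate m x) ≡ m ℕ.* x
sum-replicate zero    x = refl
sum-replicate (suc m) x = cong (x ℕ.+_) (sum-replicate m x)

two-valued : ∀ q {xs} → All (q ≤_) xs → All (_≤ suc q) xs →
  ∃ λ c → ∃ λ d → xs ↭ replicate c q ++ replicate d (suc q)
two-valued q [] [] = 0 , 0 , ↭-refl
two-valued q {x ∷ xs} (q≤x ∷ p) (x≤ ∷ p′) with two-valued q p p′ | ℕₚ.m≤n⇒m<n∨m≡n q≤x
... | c , d , π | inj₂ refl = suc c , d , prep q π
... | c , d , π | inj₁ q<x with refl ← ℕₚ.≤-antisym q<x x≤ =
  c , suc d , ↭-trans (prep _ π) (↭-sym (shift (suc q) (replicate c q) _))

-- At least one entry equals `q`, so `d` is smaller than the number of parts; hence `q` and `d` are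
-- the quotient and remainder of the sum.
two-valued-equiparts : ∀ q c d →
  let xs = replicate (suc c) q ++ replicate d (suc q) in xs ≡ equiparts (c ℕ.+ d) (sum xs)
two-valued-equiparts q c d = cong₂ _++_
  (cong₂ replicate (trans (≡-sym (ℕₚ.m+n∸n≡m (suc c) d)) (cong (suc (c ℕ.+ d) ∸_) (≡-sym rem))) (≡-sym quo))
  (cong₂ (λ r y → replicate r (suc y)) (≡-sym rem) (≡-sym quo))
  where
  xs = replicate (suc c) q ++ replicate d (suc q)
  m = suc (c ℕ.+ d)

  sum-xs : sum xs ≡ d ℕ.+ q ℕ.* m
  sum-xs = trans (sum-++ (replicate (suc c) q) _)
    (trans (cong₂ ℕ._+_ (sum-replicate (suc c) q) (sum-replicate d (suc q))) (lemma c d q))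
    where
    lemma : ∀ c d q → suc c ℕ.* q ℕ.+ d ℕ.* suc q ≡ d ℕ.+ q ℕ.* suc (c ℕ.+ d)
    lemma = ℕ-Ring.solve-∀

  d<m : d ℕ.< m
  d<m = s≤s (ℕₚ.m≤n+m d c)

  rem : sum xs % m ≡ d
  rem = trans (cong (_% m) sum-xs) (trans ([m+kn]%n≡m%n d q m) (m<n⇒m%n≡m d<m))

  quo : sum xs / m ≡ q
  quo = trans (cong (_/ m) sum-xs) (trans (+-distrib-/-∣ʳ d (divides q refl))
    (cong₂ ℕ._+_ (m<n⇒m/n≡0 d<m) (m*n/n≡m q m)))

minimum : ∀ x xs → ∃ λ y → ∃ λ ys → x ∷ xs ↭ y ∷ ys × All (y ≤_) ys
minimum x [] = x , [] , ↭-refl , []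
minimum x (z ∷ zs) with minimum z zs
... | y , ys , π , p with ℕₚ.≤-total x y
...   | inj₁ x≤y = x , y ∷ ys , prep x π , x≤y ∷ All.map (ℕₚ.≤-trans x≤y) p
...   | inj₂ y≤x = y , x ∷ ys , ↭-trans (prep x π) (swap x y ↭-refl) , y≤x ∷ p

-- The entries differ by `d + 2`. Moving one unit keeps their sum and raises their product by
-- `d + 1`, which helps when `esym r zs` is at least `c`; otherwise `esym-bound₂` makes the left
-- side non-positive.
balance-pair : ∀ r c y d zs → let x = suc (y ℕ.+ d) in
  gain r c (suc x ∷ y ∷ zs) ≤ℤ + 0 ⊎ gain r c (suc x ∷ y ∷ zs) ≤ℤ gain r c (x ∷ suc y ∷ zs)
balance-pair r c y d zs with ℕₚ.≤-total (esym r zs) c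
... | inj₁ e≤c = inj₁ (gain-nonPositive r c (suc (suc (y ℕ.+ d)) ∷ y ∷ zs)
    (esym-bound₂ r (suc (suc (y ℕ.+ d))) y zs) e≤c)
... | inj₂ c≤e = inj₂ (begin
  gain r c (suc x ∷ y ∷ zs)
    ≡⟨ gain-pair r c (suc x) y zs ⟩
  gain r c (suc x ℕ.+ y ∷ zs) + + (suc x ℕ.* y) * (+ esym r zs - + c)
    ≡⟨ cong (λ w → gain r c (w ∷ zs) + + (suc x ℕ.* y) * (+ esym r zs - + c)) (≡-sym (ℕₚ.+-suc x y)) ⟩
  gain r c (x ℕ.+ suc y ∷ zs) + + (suc x ℕ.* y) * (+ esym r zs - + c)
    ≤⟨ ℤₚ.+-monoʳ-≤ (gain r c (x ℕ.+ suc y ∷ zs))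
         (ℤₚ.*-monoʳ-≤-nonNeg (+ esym r zs - + c) {{ℤ.nonNegative (ℤₚ.i≤j⇒0≤j-i (ℤ.+≤+ c≤e))}}
           (ℤ.+≤+ products)) ⟩
  gain r c (x ℕ.+ suc y ∷ zs) + + (x ℕ.* suc y) * (+ esym r zs - + c)
    ≡⟨ gain-pair r c x (suc y) zs ⟨
  gain r c (x ∷ suc y ∷ zs) ∎)
  where
  open ℤₚ.≤-Reasoning
  x = suc (y ℕ.+ d)
  products : suc x ℕ.* y ≤ x ℕ.* suc y
  products = subst (suc x ℕ.* y ≤_) (lemma y d) (ℕₚ.m≤m+n _ (suc d))
    where
    lemma : ∀ y d → suc (suc (y ℕ.+ d)) ℕ.* y ℕ.+ suc d ≡ suc (y ℕ.+ d) ℕ.* suc y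
    lemma = ℕ-Ring.solve-∀

-- In `esym 2` the product of the two entries has coefficient 1, so balancing always helps.
balance-edges : ∀ y d zs → let x = suc (y ℕ.+ d) in esym 2 (suc x ∷ y ∷ zs) ≤ esym 2 (x ∷ suc y ∷ zs)
balance-edges y d zs = subst (esym 2 (suc (suc (y ℕ.+ d)) ∷ y ∷ zs) ≤_)
  (lemma (esym 2 zs) (esym 1 zs) y d) (ℕₚ.m≤m+n _ (suc d))
  where
  lemma : ∀ e f y d → e ℕ.+ y ℕ.* f ℕ.+ suc (suc (y ℕ.+ d)) ℕ.* (f ℕ.+ y ℕ.* 1) ℕ.+ suc d
    ≡ e ℕ.+ suc y ℕ.* f ℕ.+ suc (y ℕ.+ d) ℕ.* (f ℕ.+ suc y ℕ.* 1)
  lemma = ℕ-Ring.solve-∀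

-- Termination measure for balancing: moving a unit between entries that differ by `d + 2` lowers it
-- by `2 * d + 2`.
squares : List ℕ → ℕ
squares = sum ∘ map (λ x → x ℕ.* x)

-- The fields `parts` and `total` do not mention `xs`; they are read off when balancing ends, where
-- `equiparts m n` is a rearrangement of the balanced list.
record EquipartsOptimal (r c m n : ℕ) (xs : List ℕ) : Set where
  field
    parts : length (equiparts m n) ≡ suc m
    total : sum (equiparts m n) ≡ n
    edges : esym 2 xs ≤ esym 2 (equiparts m n)
    gains : gain r c xs ≤ℤ + 0 ⊎ gain r c xs ≤ℤ gain r c (equiparts m n)

-- Bring a least entry `y` to the front. Either every other entry is at most `y + 1` and the list is
-- the Turán one up to order, or one unit moves to `y` from an entry of at least `y + 2`.
equiparts-optimal : ∀ r c {m n} xs → length xs ≡ suc m → sum xs ≡ n → EquipartsOptimal r c m n xs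
equiparts-optimal r c {m} {n} xs len tot = go (suc (squares xs)) xs len tot ℕₚ.≤-refl
  where
  resp : ∀ {xs ys} → xs ↭ ys → EquipartsOptimal r c m n ys → EquipartsOptimal r c m n xs
  resp π o = record
    { parts = parts ; total = total
    ; edges = subst (_≤ _) (≡-sym (esym-↭ 2 π)) edges
    ; gains = subst (λ g → g ≤ℤ + 0 ⊎ g ≤ℤ _) (≡-sym (gain-↭ r c π)) gains }
    where open EquipartsOptimal o

  go : ∀ f xs → length xs ≡ suc m → sum xs ≡ n → squares xs ℕ.< f → EquipartsOptimal r c m n xs
  go (suc f) (x ∷ xs) len tot (s≤s bound) with minimum x xs
  ... | y , ys , π , p with findCounterexample (ℕ._≤? suc y) ys
  ...   | inj₁ p′ with two-valued y p p′
  ...     | k , d , ρ = resp σ (record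
    { parts = trans (cong length eq) (trans (≡-sym (↭-length σ)) len)
    ; total = trans (cong sum eq) (trans (≡-sym (sum-↭ σ)) tot)
    ; edges = ℕₚ.≤-reflexive (cong (esym 2) (≡-sym eq))
    ; gains = inj₂ (ℤₚ.≤-reflexive (cong (gain r c) (≡-sym eq))) })
    where
    zs = replicate (suc k) y ++ replicate d (suc y)
    σ : x ∷ xs ↭ zs
    σ = ↭-trans π (prep y ρ)
    length-zs : length zs ≡ suc (k ℕ.+ d)
    length-zs = trans (length-++ (replicate (suc k) y)) (cong₂ ℕ._+_ (length-replicate (suc k)) (length-replicate d))
    eq : equiparts m n ≡ zs
    eq = trans (cong₂ equiparts
                  (ℕₚ.suc-injective (trans (≡-sym len) (trans (↭-length σ) length-zs)))
                  (trans (≡-sym tot) (sum-↭ σ)))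
               (≡-sym (two-valued-equiparts y k d))
  go (suc f) (x ∷ xs) len tot (s≤s bound) | y , ys , π , p | inj₂ (z , zs , ρ , z≰)
    -- The large entry is `y + 2 + d`, the form used in `balance-pair`.
    with ℕₚ.m≤n⇒∃[o]m+o≡n (ℕₚ.≰⇒> z≰)
  ... | d , refl = resp σ (record
    { parts = parts
    ; total = total
    ; edges = ℕₚ.≤-trans (balance-edges y d zs) edges
    ; gains = combine (balance-pair r c y d zs) gains })
    where
    new = suc (y ℕ.+ d) ∷ suc y ∷ zs
    σ : x ∷ xs ↭ suc (suc (y ℕ.+ d)) ∷ y ∷ zs
    σ = ↭-trans π (↭-trans (prep y ρ) (swap _ _ ↭-refl))
    same : sum new ≡ sum (suc (suc (y ℕ.+ d)) ∷ y ∷ zs)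
    same = lemma y d (sum zs)
      where
      lemma : ∀ y d s → suc (y ℕ.+ d) ℕ.+ (suc y ℕ.+ s) ≡ suc (suc (y ℕ.+ d)) ℕ.+ (y ℕ.+ s)
      lemma = ℕ-Ring.solve-∀
    smaller : squares new ℕ.< f
    smaller = ℕₚ.≤-trans
      (subst (suc (squares new) ≤_) (lemma y d (squares zs)) (ℕₚ.m≤m+n _ (suc (d ℕ.+ d))))
      (subst (_≤ f) (sum-↭ (map⁺ (λ x → x ℕ.* x) σ)) bound)
      where
      lemma : ∀ y d s → suc (suc (y ℕ.+ d) ℕ.* suc (y ℕ.+ d) ℕ.+ (suc y ℕ.* suc y ℕ.+ s)) ℕ.+ suc (d ℕ.+ d)
        ≡ suc (suc (y ℕ.+ d)) ℕ.* suc (suc (y ℕ.+ d)) ℕ.+ (y ℕ.* y ℕ.+ s)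
      lemma = ℕ-Ring.solve-∀
    open EquipartsOptimal (go f new (trans (≡-sym (↭-length σ)) len) (trans same (trans (≡-sym (sum-↭ σ)) tot)) smaller)
    combine : ∀ {a b c} → a ≤ℤ + 0 ⊎ a ≤ℤ b → b ≤ℤ + 0 ⊎ b ≤ℤ c → a ≤ℤ + 0 ⊎ a ≤ℤ c
    combine (inj₁ p) _        = inj₁ p
    combine (inj₂ p) (inj₁ q) = inj₁ (ℤₚ.≤-trans p q)
    combine (inj₂ p) (inj₂ q) = inj₂ (ℤₚ.≤-trans p q)

-- Counting cliques and edges of graphs on Fin n

countᵇ-++ : ∀ {A : Set} (p : A → Bool) xs ys → countᵇ p (xs ++ ys) ≡ countᵇ p xs ℕ.+ countᵇ p ys
countᵇ-++ p []       ys = refl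
countᵇ-++ p (x ∷ xs) ys with p x
... | false = countᵇ-++ p xs ys
... | true  = cong suc (countᵇ-++ p xs ys)

countᵇ-map : ∀ {A B : Set} (p : B → Bool) (f : A → B) xs → countᵇ p (map f xs) ≡ countᵇ (p ∘ f) xs
countᵇ-map p f []       = refl
countᵇ-map p f (x ∷ xs) with p (f x)
... | false = countᵇ-map p f xs
... | true  = cong suc (countᵇ-map p f xs)

countᵇ-cong : ∀ {A : Set} {p q : A → Bool} → (∀ x → p x ≡ q x) → ∀ xs → countᵇ p xs ≡ countᵇ q xs
countᵇ-cong e [] = refl
countᵇ-cong {q = q} e (x ∷ xs) rewrite e x with q x
... | false = countᵇ-cong e xs
... | true  = cong suc (countᵇ-cong e xs)

countᵇ-none : ∀ {A : Set} (xs : List A) → countᵇ (λ _ → false) xs ≡ 0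
countᵇ-none []       = refl
countᵇ-none (x ∷ xs) = countᵇ-none xs

countᵇ-concatMap : ∀ {A B : Set} (p : B → Bool) (g : A → List B) xs →
  countᵇ p (concatMap g xs) ≡ sum (map (λ x → countᵇ p (g x)) xs)
countᵇ-concatMap p g []       = refl
countᵇ-concatMap p g (x ∷ xs) =
  trans (countᵇ-++ p (g x) (concatMap g xs)) (cong (countᵇ p (g x) ℕ.+_) (countᵇ-concatMap p g xs))

∧-true : ∀ {x y} → x ∧ y ≡ true → x ≡ true × y ≡ true
∧-true {true} e = refl , e

allᵇ-tabulate : ∀ {A : Set} (p : A → Bool) {n} (f : Fin n → A) →
  allᵇ p (tabulate f) ≡ true ⇔ (∀ i → p (f i) ≡ true)
allᵇ-tabulate p f = mk⇔ (to f) (from f)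
  where
  to : ∀ {n} (f : Fin n → _) → allᵇ p (tabulate f) ≡ true → ∀ i → p (f i) ≡ true
  to f e zero    = proj₁ (∧-true e)
  to f e (suc i) = to (f ∘ suc) (proj₂ (∧-true {p (f zero)} e)) i
  from : ∀ {n} (f : Fin n → _) → (∀ i → p (f i) ≡ true) → allᵇ p (tabulate f) ≡ true
  from {zero}  f h = refl
  from {suc n} f h rewrite h zero = from (f ∘ suc) (h ∘ suc)

filterᵇ-true : ∀ {A : Set} (xs : List A) → filterᵇ (λ _ → true) xs ≡ xs
filterᵇ-true []       = refl
filterᵇ-true (x ∷ xs) = cong (x ∷_) (filterᵇ-true xs)

units : ∀ {V : Set} {n} → (Fin n → V) → Weighted {V}
units f = tabulate (λ i → f i , 1)

PairwiseIn : ∀ {n} → Subset n → (Fin n → Fin n → Bool) → Set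
PairwiseIn S e = ∀ i j → Vec.lookup S i ≡ true → Vec.lookup S j ≡ true → i ≢ j → e i j ≡ true

isCliqueᵇ-true : ∀ {n} (G : Graph n) S → isCliqueᵇ G S ≡ true ⇔ PairwiseIn S (adj G)
isCliqueᵇ-true G S = mk⇔
  (λ e i j → Equivalence.to (entry (Vec.lookup S i) (Vec.lookup S j) (i Fin.≟ j) (adj G i j))
    (Equivalence.to (allᵇ-tabulate _ _) (Equivalence.to (allᵇ-tabulate _ _) e i) j))
  (λ h → Equivalence.from (allᵇ-tabulate _ _) λ i → Equivalence.from (allᵇ-tabulate _ _) λ j →
    Equivalence.from (entry (Vec.lookup S i) (Vec.lookup S j) (i Fin.≟ j) (adj G i j)) (h i j))
  where
  entry : ∀ {P : Set} s t (d : Dec P) e →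
    not (s ∧ t ∧ not ⌊ d ⌋) ∨ e ≡ true ⇔ (s ≡ true → t ≡ true → ¬ P → e ≡ true)
  entry false t     d       e = mk⇔ (λ _ ()) (λ _ → refl)
  entry true  false d       e = mk⇔ (λ _ _ ()) (λ _ → refl)
  entry true  true  (yes p) e = mk⇔ (λ _ _ _ ¬p → contradiction p ¬p) (λ _ → refl)
  entry true  true  (no ¬p) e = mk⇔ (λ h _ _ _ → h) (λ h → h refl refl ¬p)

module _ {V : Set} (a : V → V → Bool) where

  -- The candidate set p is narrowed to the neighbourhood of each chosen vertex, as in the
  -- recursion defining cliques.
  cliqueIn : (V → Bool) → ∀ {n} → (Fin n → V) → Subset n → Bool
  cliqueIn p f []          = true
  cliqueIn p f (false ∷ S) = cliqueIn p (f ∘ suc) S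
  cliqueIn p f (true ∷ S)  = p (f zero) ∧ cliqueIn (λ v → p v ∧ a (f zero) v) (f ∘ suc) S

  -- Subsets without and with the first vertex give the two summands of the recursion for `cliques`;
  -- narrowing `p` amounts to composing filters.
  cliqueIn-count : ∀ r p {n} (f : Fin n → V) →
    countᵇ (λ S → ⌊ ∣ S ∣ ℕ.≟ r ⌋ ∧ cliqueIn p f S) (allSubsets n)
      ≡ cliques a r (filterᵇ (p ∘ proj₁) (units f))
  cliqueIn-count zero    p {zero}  f = refl
  cliqueIn-count (suc r) p {zero}  f = refl
  cliqueIn-count r p {suc n} f = trans (countᵇ-++ P (map (false ∷_) (allSubsets n)) _)
    (trans (cong₂ ℕ._+_
        (trans (countᵇ-map P (false ∷_) (allSubsets n)) (cliqueIn-count r p (f ∘ suc)))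
        (countᵇ-map P (true ∷_) (allSubsets n)))
      (insideCount r))
    where
    P : Subset (suc n) → Bool
    P S = ⌊ ∣ S ∣ ℕ.≟ r ⌋ ∧ cliqueIn p f S
    ≟-suc : ∀ m r → ⌊ suc m ℕ.≟ suc r ⌋ ≡ ⌊ m ℕ.≟ r ⌋
    ≟-suc m r = trans (isYes≗does (suc m ℕ.≟ suc r)) (≡-sym (isYes≗does (m ℕ.≟ r)))
    rest = filterᵇ (p ∘ proj₁) (units (f ∘ suc))
    insideCount : ∀ r →
      cliques a r rest ℕ.+ countᵇ (λ S → ⌊ suc ∣ S ∣ ℕ.≟ r ⌋ ∧ cliqueIn p f (true ∷ S)) (allSubsets n)
        ≡ cliques a r (filterᵇ (p ∘ proj₁) (units f))
    insideCount zero = cong suc (countᵇ-none (allSubsets n))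
    insideCount (suc r) with p (f zero)
    ... | false = trans (cong (cliques a (suc r) rest ℕ.+_)
      (trans (countᵇ-cong (λ S → Boolₚ.∧-zeroʳ ⌊ suc ∣ S ∣ ℕ.≟ suc r ⌋) (allSubsets n))
             (countᵇ-none (allSubsets n)))) (ℕₚ.+-identityʳ _)
    ... | true = cong (cliques a (suc r) rest ℕ.+_)
      (trans (countᵇ-cong (λ S → cong (_∧ cliqueIn p′ (f ∘ suc) S) (≟-suc ∣ S ∣ r)) (allSubsets n))
      (trans (cliqueIn-count r p′ (f ∘ suc))
      (trans (cong (cliques a r) (≡-sym (filterᵇ-filterᵇ _ _ (units (f ∘ suc)))))
             (≡-sym (ℕₚ.+-identityʳ _)))))
      where
      p′ : V → Bool
      p′ v = p v ∧ a (f zero) v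

  -- Each pair is tested in one order only, so symmetry of `a` supplies the other.
  cliqueIn-true : (∀ u v → a u v ≡ a v u) → ∀ p {n} (f : Fin n → V) S → cliqueIn p f S ≡ true ⇔
    ((∀ i → Vec.lookup S i ≡ true → p (f i) ≡ true) × PairwiseIn S (λ i j → a (f i) (f j)))
  cliqueIn-true a-sym p f S = mk⇔ (to p f S) (λ (h , g) → from p f S h g)
    where
    to : ∀ p {n} (f : Fin n → V) S → cliqueIn p f S ≡ true →
      (∀ i → Vec.lookup S i ≡ true → p (f i) ≡ true) × PairwiseIn S (λ i j → a (f i) (f j))
    to p f [] e = (λ ()) , (λ ())
    to p f (false ∷ S) e with to p (f ∘ suc) S e
    ... | h , g = (λ { (suc i) → h i }) ,
                  (λ { (suc i) (suc j) s t ne → g i j s t (ne ∘ cong suc) })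
    to p f (true ∷ S) e with ∧-true {p (f zero)} e
    ... | p0 , e′ with to (λ v → p v ∧ a (f zero) v) (f ∘ suc) S e′
    ...   | h , g =
      (λ { zero _ → p0 ; (suc i) s → proj₁ (∧-true (h i s)) }) ,
      (λ { zero zero _ _ ne → contradiction refl ne
         ; zero (suc j) _ t _ → proj₂ (∧-true {p (f (suc j))} (h j t))
         ; (suc i) zero s _ _ → trans (a-sym _ _) (proj₂ (∧-true {p (f (suc i))} (h i s)))
         ; (suc i) (suc j) s t ne → g i j s t (ne ∘ cong suc) })
    from : ∀ p {n} (f : Fin n → V) S → (∀ i → Vec.lookup S i ≡ true → p (f i) ≡ true) →
      PairwiseIn S (λ i j → a (f i) (f j)) → cliqueIn p f S ≡ true
    from p f [] h g = refl
    from p f (false ∷ S) h g =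
      from p (f ∘ suc) S (h ∘ suc) (λ i j s t ne → g (suc i) (suc j) s t λ { refl → ne refl })
    from p f (true ∷ S) h g = cong₂ _∧_ (h zero refl)
      (from _ (f ∘ suc) S (λ i s → cong₂ _∧_ (h (suc i) s) (g zero (suc i) refl s λ ()))
        (λ i j s t ne → g (suc i) (suc j) s t λ { refl → ne refl }))

  -- The map `f` may identify vertices: it is the identity for a given graph and the assignment of
  -- parts for a multipartite one.
  copiesK-cliques : (∀ u v → a u v ≡ a v u) → ∀ {n} (f : Fin n → V) (G : Graph n) →
    (∀ i j → adj G i j ≡ a (f i) (f j)) → ∀ r → copiesK r G ≡ cliques a r (units f)
  copiesK-cliques a-sym {n} f G eq r = trans
    (countᵇ-cong (λ S → cong (⌊ ∣ S ∣ ℕ.≟ r ⌋ ∧_) (⇔→≡ (mk⇔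
      (λ e → Equivalence.from (cliqueIn-true a-sym (λ _ → true) f S) ((λ _ _ → refl) ,
        λ i j s t ne → trans (≡-sym (eq i j)) (Equivalence.to (isCliqueᵇ-true G S) e i j s t ne)))
      (λ e → Equivalence.from (isCliqueᵇ-true G S) λ i j s t ne → trans (eq i j)
        (proj₂ (Equivalence.to (cliqueIn-true a-sym (λ _ → true) f S) e) i j s t ne))))) (allSubsets n))
    (trans (cliqueIn-count r (λ _ → true) f) (cong (cliques a r) (filterᵇ-true (units f))))

  countᵇ-units : ∀ q {n} (f : Fin n → V) →
    countᵇ (λ x → x) (tabulate (q ∘ f)) ≡ cliques a 1 (filterᵇ (q ∘ proj₁) (units f))
  countᵇ-units q {zero}  f = refl
  countᵇ-units q {suc n} f with q (f zero)
  ... | false = countᵇ-units q (f ∘ suc)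
  ... | true  = trans (cong suc (countᵇ-units q (f ∘ suc))) (ℕₚ.+-comm 1 _)

  upperPairs-count : ∀ {n} (f : Fin n → V) →
    sum (tabulate (λ i → countᵇ (λ x → x) (tabulate (λ j → (toℕ i <ᵇ toℕ j) ∧ a (f i) (f j)))))
      ≡ cliques a 2 (units f)
  upperPairs-count {zero}  f = refl
  upperPairs-count {suc n} f = trans
    (cong₂ ℕ._+_ (countᵇ-units (a (f zero)) (f ∘ suc)) (upperPairs-count (f ∘ suc)))
    (trans (ℕₚ.+-comm (cliques a 1 (nbrs a (f zero) (units (f ∘ suc)))) _)
           (cong (cliques a 2 (units (f ∘ suc)) ℕ.+_) (≡-sym (ℕₚ.+-identityʳ _))))

  edgeCount-cliques : ∀ {n} (f : Fin n → V) (G : Graph n) →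
    (∀ i j → adj G i j ≡ a (f i) (f j)) → edgeCount G ≡ cliques a 2 (units f)
  edgeCount-cliques {n} f G eq = begin
    edgeCount G
      ≡⟨ countᵇ-concatMap (λ x → x) (λ i → map (row i) (allFin n)) (allFin n) ⟩
    sum (map (λ i → countᵇ (λ x → x) (map (row i) (allFin n))) (allFin n))
      ≡⟨ cong sum (map-tabulate {n = n} (λ i → i) (λ i → countᵇ (λ x → x) (map (row i) (allFin n)))) ⟩
    sum (tabulate (λ i → countᵇ (λ x → x) (map (row i) (allFin n))))
      ≡⟨ cong sum (tabulate-cong λ i → cong (countᵇ (λ x → x))
           (trans (map-tabulate (λ j → j) (row i)) (tabulate-cong λ j → cong ((toℕ i <ᵇ toℕ j) ∧_) (eq i j)))) ⟩
    sum (tabulate (λ i → countᵇ (λ x → x) (tabulate (λ j → (toℕ i <ᵇ toℕ j) ∧ a (f i) (f j)))))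
      ≡⟨ upperPairs-count f ⟩
    cliques a 2 (units f) ∎
    where
    open ≡-Reasoning
    row : Fin n → Fin n → Bool
    row i j = (toℕ i <ᵇ toℕ j) ∧ adj G i j

-- Complete multipartite graphs

module _ {V : Set} where

  blowUp : Weighted {V} → List V
  blowUp []            = []
  blowUp ((v , x) ∷ L) = replicate x v ++ blowUp L

  unit : V → V × ℕ
  unit v = v , 1

  length-blowUp : ∀ L → length (blowUp L) ≡ sum (weights L)
  length-blowUp []            = refl
  length-blowUp ((v , x) ∷ L) =
    trans (length-++ (replicate x v)) (cong₂ ℕ._+_ (length-replicate x) (length-blowUp L))

  module _ (a : V → V → Bool) (a-irrefl : ∀ v → a v v ≡ false) where

    nbrs-skip : ∀ {u v} → a u v ≡ false → ∀ x vs →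
      nbrs a u (map unit (replicate x v ++ vs)) ≡ nbrs a u (map unit vs)
    nbrs-skip e zero    vs = refl
    nbrs-skip e (suc x) vs rewrite e = nbrs-skip e x vs

    nbrs-keep : ∀ {u v} → a u v ≡ true → ∀ x {vs ws} → nbrs a u (map unit vs) ≡ map unit ws →
      nbrs a u (map unit (replicate x v ++ vs)) ≡ map unit (replicate x v ++ ws)
    nbrs-keep e zero    h = h
    nbrs-keep e (suc x) h rewrite e = cong (_ ∷_) (nbrs-keep e x h)

    nbrs-blowUp : ∀ u L → nbrs a u (map unit (blowUp L)) ≡ map unit (blowUp (nbrs a u L))
    nbrs-blowUp u [] = refl
    nbrs-blowUp u ((v , x) ∷ L) with a u v in eq
    ... | false = trans (nbrs-skip eq x (blowUp L)) (nbrs-blowUp u L)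
    ... | true  = nbrs-keep eq x (nbrs-blowUp u L)

    -- By irreflexivity the copies of `v` are independent, so each sees only the neighbours in `vs`.
    cliques-replicate : ∀ r v x vs → cliques a (suc r) (map unit (replicate x v ++ vs))
      ≡ cliques a (suc r) (map unit vs) ℕ.+ x ℕ.* cliques a r (nbrs a v (map unit vs))
    cliques-replicate r v zero    vs = ≡-sym (ℕₚ.+-identityʳ _)
    cliques-replicate r v (suc x) vs
      rewrite cliques-replicate r v x vs | nbrs-skip (a-irrefl v) x vs =
      lemma (cliques a (suc r) (map unit vs)) (cliques a r (nbrs a v (map unit vs))) x
      where
      lemma : ∀ e f x → e ℕ.+ x ℕ.* f ℕ.+ 1 ℕ.* f ≡ e ℕ.+ suc x ℕ.* f
      lemma = ℕ-Ring.solve-∀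

    cliques-blowUp : ∀ r L → cliques a r (map unit (blowUp L)) ≡ cliques a r L
    cliques-blowUp zero    L  = refl
    cliques-blowUp (suc r) [] = refl
    cliques-blowUp (suc r) ((v , x) ∷ L) = trans (cliques-replicate r v x (blowUp L))
      (cong₂ (λ e f → e ℕ.+ x ℕ.* f) (cliques-blowUp (suc r) L)
        (trans (cong (cliques a r) (nbrs-blowUp v L)) (cliques-blowUp r (nbrs a v L))))

distinct : ℕ → ℕ → Bool
distinct i j = not (i ≡ᵇ j)

distinct-sym : ∀ i j → distinct i j ≡ distinct j i
distinct-sym zero    zero    = refl
distinct-sym zero    (suc j) = refl
distinct-sym (suc i) zero    = refl
distinct-sym (suc i) (suc j) = distinct-sym i j

distinct-irrefl : ∀ i → distinct i i ≡ false
distinct-irrefl zero    = refl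
distinct-irrefl (suc i) = distinct-irrefl i

distinct-> : ∀ {i j} → j ℕ.< i → distinct i j ≡ true
distinct-> {suc i} {zero}  _         = refl
distinct-> {suc i} {suc j} (s≤s j<i) = distinct-> j<i

-- Tail lengths strictly decrease along the list, so the labels are pairwise distinct.
label : List ℕ → Weighted
label []       = []
label (x ∷ xs) = (length xs , x) ∷ label xs

weights-label : ∀ xs → weights (label xs) ≡ xs
weights-label []       = refl
weights-label (x ∷ xs) = cong (x ∷_) (weights-label xs)

label-complete : ∀ xs → Complete distinct (label xs)
label-complete []       = []
label-complete (x ∷ xs) = All.map distinct-> (labels< xs) ∷ label-complete xs
  where
  labels< : ∀ xs → All (λ e → proj₁ e ℕ.< length xs) (label xs)
  labels< []       = []
  labels< (x ∷ xs) = ℕₚ.≤-refl ∷ All.map ℕₚ.m<n⇒m<1+n (labels< xs)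

-- The graph is a blow-up of the complete graph whose vertices are the entries of `xs`.
completeMultipartite : ∀ {n} xs → sum xs ≡ n →
  Σ (Graph n) λ G → (∀ r → copiesK r G ≡ esym r xs) × edgeCount G ≡ esym 2 xs
completeMultipartite xs refl
  -- Rewriting the sum as the length of the blow-up lets `lookup` assign parts to the vertices.
  with sum xs | trans (length-blowUp (label xs)) (cong sum (weights-label xs))
... | .(length (blowUp (label xs))) | refl =
  G , (λ r → trans (copiesK-cliques distinct distinct-sym part G (λ _ _ → refl) r) (count r))
    , trans (edgeCount-cliques distinct part G (λ _ _ → refl)) (count 2)
  where
  vs = blowUp (label xs)
  part = lookup vs
  G = record
    { adj    = λ i j → distinct (part i) (part j)
    ; sym    = λ i j → distinct-sym (part i) (part j)
    ; irrefl = λ i → distinct-irrefl (part i) }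
  count : ∀ r → cliques distinct r (units part) ≡ esym r xs
  count r = begin
    cliques distinct r (units part)
      ≡⟨ cong (cliques distinct r) (≡-sym (map-tabulate part unit)) ⟩
    cliques distinct r (map unit (tabulate part))
      ≡⟨ cong (cliques distinct r ∘ map unit) (tabulate-lookup vs) ⟩
    cliques distinct r (map unit vs)
      ≡⟨ cliques-blowUp distinct distinct-irrefl r (label xs) ⟩
    cliques distinct r (label xs)
      ≡⟨ cliques-complete r (label-complete xs) ⟩
    esym r (weights (label xs))
      ≡⟨ cong (esym r) (weights-label xs) ⟩
    esym r xs ∎
    where open ≡-Reasoning

-- Blue-red graphs

-- On a clique the term for all edges turns the coefficient `t = s + 1` into `t - 1 = s`.
gain-+esym₂ : ∀ r s xs → gain r (suc s) xs + + esym 2 xs ≡ gain r s xs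
gain-+esym₂ r s xs = lemma (+ esym (suc (suc r)) xs) (+ s) (+ esym 2 xs)
  where
  lemma : ∀ e s f → e - (+ 1 + s) * f + f ≡ e - s * f
  lemma = ℤ-Ring.solve-∀

module _ {V : Set} {a b : V → V → Bool}
  (a-sym : ∀ u v → a u v ≡ a v u) (b-sym : ∀ u v → b u v ≡ b v u)
  (b⊆a : ∀ u v → a u v ≡ false → b u v ≡ false) where

  -- Pairs that are not edges of `a` are merged until a clique remains. Weights are kept positive,
  -- so that a vanishing weighted count really excludes cliques on `m + 2` vertices.
  coloured-bound : ∀ r s m n L → All (1 ≤_) (weights L) → cliques a (suc (suc m)) L ≡ 0 →
    sum (weights L) ≡ n → let T = equiparts m n ; value = net b r (suc s) L + + cliques a 2 L in
    value ≤ℤ + esym 2 T ⊎ value ≤ℤ gain r s T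
  coloured-bound r s m n = mergeInduction a Q base resp step
    where
    T = equiparts m n
    k = suc (suc m)

    Φ : Weighted → ℤ
    Φ L = net b r (suc s) L + + cliques a 2 L

    slope : V → Weighted → ℤ
    slope u L = net-slope b r (suc s) u L + + cliques a 1 (nbrs a u L)

    affine : ∀ u x L → Φ ((u , x) ∷ L) ≡ Φ L + + x * slope u L
    affine u x L = trans
      (cong₂ _+_ (net-affine b r (suc s) u x L) (pos-+* (cliques a 2 L) x (cliques a 1 (nbrs a u L))))
      (lemma (net b r (suc s) L) (+ x) (net-slope b r (suc s) u L)
             (+ cliques a 2 L) (+ cliques a 1 (nbrs a u L)))
      where
      lemma : ∀ e x f g h → e + x * f + (g + x * h) ≡ e + g + x * (f + h)
      lemma = ℤ-Ring.solve-∀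

    Bounded : ℤ → Set
    Bounded z = z ≤ℤ + esym 2 T ⊎ z ≤ℤ gain r s T

    bounded-≤ : ∀ {y z} → y ≤ℤ z → Bounded z → Bounded y
    bounded-≤ p (inj₁ q) = inj₁ (ℤₚ.≤-trans p q)
    bounded-≤ p (inj₂ q) = inj₂ (ℤₚ.≤-trans p q)

    Q : Weighted → Set
    Q L = All (1 ≤_) (weights L) → cliques a k L ≡ 0 → sum (weights L) ≡ n → Bounded (Φ L)

    base : ∀ L → Complete a L → Q L
    base L c pos free tot = conclude (net-bound b-sym r (suc s) L)
      where
      ws = weights L

      few : length ws ≤ suc m
      few with ℕₚ.≤-<-connex k (length ws)
      ... | inj₂ l = ℕ.s≤s⁻¹ l
      ... | inj₁ l with () ← subst (1 ≤_) (trans (≡-sym (cliques-complete k c)) free) (esym-positive k pos l)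

      -- Empty parts bring the number of parts to exactly `m + 1` without changing `esym`.
      j = suc m ∸ length ws
      padded = replicate j 0 ++ ws

      opt : EquipartsOptimal r s m n padded
      opt = equiparts-optimal r s padded
        (trans (length-++ (replicate j 0))
          (trans (cong (ℕ._+ length ws) (length-replicate j)) (ℕₚ.m∸n+n≡m few)))
        (trans (sum-++ (replicate j 0) ws)
          (trans (cong (ℕ._+ sum ws) (trans (sum-replicate j 0) (ℕₚ.*-zeroʳ j))) tot))
      open EquipartsOptimal opt

      edges≤ : + cliques a 2 L ≤ℤ + esym 2 T
      edges≤ = ℤ.+≤+ (subst (_≤ esym 2 T)
        (trans (esym-zeros 2 j ws) (≡-sym (cliques-complete 2 c))) edges)

      Φ-complete : gain r (suc s) ws + + cliques a 2 L ≡ gain r s padded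
      Φ-complete = trans (cong (λ e → gain r (suc s) ws + + e) (cliques-complete 2 c))
        (trans (gain-+esym₂ r s ws)
          (≡-sym (cong₂ (λ e f → + e - + s * + f) (esym-zeros (suc (suc r)) j ws) (esym-zeros 2 j ws))))

      gains′ : gain r s padded ≤ℤ + 0 ⊎ gain r s padded ≤ℤ gain r s T → Bounded (gain r s padded)
      -- A non-positive value lies below any edge count.
      gains′ (inj₁ p) = inj₁ (ℤₚ.≤-trans p (ℤ.+≤+ z≤n))
      gains′ (inj₂ p) = inj₂ p

      conclude : net b r (suc s) L ≤ℤ + 0 ⊎ net b r (suc s) L ≤ℤ gain r (suc s) ws → Bounded (Φ L)
      -- The blue part contributes at most 0, which leaves the edge term.
      conclude (inj₁ p) = inj₁ (ℤₚ.≤-trans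
        (subst (Φ L ≤ℤ_) (ℤₚ.+-identityˡ _) (ℤₚ.+-monoˡ-≤ (+ cliques a 2 L) p)) edges≤)
      conclude (inj₂ p) = bounded-≤
        (subst (Φ L ≤ℤ_) Φ-complete (ℤₚ.+-monoˡ-≤ (+ cliques a 2 L) p)) (gains′ gains)

    resp : ∀ {L M} → L ↭ M → Q L → Q M
    resp {L} {M} π q pos free tot =
      subst Bounded (cong₂ (λ y e → y + + e) (net-↭ b-sym r (suc s) π) (cliques-↭ a-sym 2 π))
        (q (All-resp-↭ (map⁺ proj₂ (↭-sym π)) pos)
           (trans (cliques-↭ a-sym k π) free)
           (trans (sum-↭ (map⁺ proj₂ π)) tot))

    step : ∀ u x v y L → a u v ≡ false →
      Q ((u , x ℕ.+ y) ∷ L) → Q ((v , x ℕ.+ y) ∷ L) → Q ((u , x) ∷ (v , y) ∷ L)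
    step u x@(suc x′) v y@(suc y′) L e qu qv (px ∷ py ∷ pos) free tot = conclude
      (merge-affine Φ slope affine u x v y L
        (cong₂ (λ N M → + cliques b (suc r) N - + suc s * + cliques b 1 N + + cliques a 1 M)
          (nbrs-nonadjacent b y L (b⊆a u v e)) skip))
      where
      skip : nbrs a u ((v , y) ∷ L) ≡ nbrs a u L
      skip = nbrs-nonadjacent a y L e

      -- The count is a sum of naturals and `x`, `y` are positive, so its vanishing passes to `L`
      -- and to the neighbourhoods of `u` and `v`; both merged lists are then free as well.
      rest≡0 : cliques a k L ℕ.+ y ℕ.* cliques a (suc m) (nbrs a v L) ≡ 0
      rest≡0 = ℕₚ.m+n≡0⇒m≡0 _ free

      factor≡0 : ∀ x {e} → suc x ℕ.* e ≡ 0 → e ≡ 0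
      factor≡0 x p = ℕₚ.m+n≡0⇒m≡0 _ p

      Φ-free : ∀ {w} → cliques a (suc m) (nbrs a w L) ≡ 0 → cliques a k ((w , x ℕ.+ y) ∷ L) ≡ 0
      Φ-free z = cong₂ ℕ._+_ (ℕₚ.m+n≡0⇒m≡0 (cliques a k L) rest≡0)
        (trans (cong (λ e → (x ℕ.+ y) ℕ.* e) z) (ℕₚ.*-zeroʳ (x ℕ.+ y)))

      free-u : cliques a k ((u , x ℕ.+ y) ∷ L) ≡ 0
      free-u = Φ-free (trans (cong (cliques a (suc m)) (≡-sym skip))
        (factor≡0 x′ (ℕₚ.m+n≡0⇒n≡0 (cliques a k ((v , y) ∷ L)) free)))

      free-v : cliques a k ((v , x ℕ.+ y) ∷ L) ≡ 0
      free-v = Φ-free (factor≡0 y′ (ℕₚ.m+n≡0⇒n≡0 (cliques a k L) rest≡0))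

      tot′ : x ℕ.+ y ℕ.+ sum (weights L) ≡ n
      tot′ = trans (ℕₚ.+-assoc x y _) tot

      conclude : Φ ((u , x) ∷ (v , y) ∷ L) ≤ℤ Φ ((u , x ℕ.+ y) ∷ L) ⊎
                 Φ ((u , x) ∷ (v , y) ∷ L) ≤ℤ Φ ((v , x ℕ.+ y) ∷ L) →
                 Bounded (Φ ((u , x) ∷ (v , y) ∷ L))
      conclude (inj₁ p) = bounded-≤ p (qu (s≤s z≤n ∷ pos) free-u tot′)
      conclude (inj₂ p) = bounded-≤ p (qv (s≤s z≤n ∷ pos) free-v tot′)

  coloured-bound-units : ∀ r s m {n} (f : Fin n → V) → cliques a (suc (suc m)) (units f) ≡ 0 →
    let T = equiparts m n ; value = net b r (suc s) (units f) + + cliques a 2 (units f) in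
    value ≤ℤ + esym 2 T ⊎ value ≤ℤ gain r s T
  coloured-bound-units r s m f free =
    coloured-bound r s m _ (units f) (positive f) free (total f)
    where
    positive : ∀ {n} (f : Fin n → V) → All (1 ≤_) (weights (units f))
    positive {zero}  f = []
    positive {suc n} f = ℕₚ.≤-refl ∷ positive (f ∘ suc)
    total : ∀ {n} (f : Fin n → V) → sum (weights (units f)) ≡ n
    total {zero}  f = refl
    total {suc n} f = cong suc (total (f ∘ suc))

edges-by-colour : ∀ {V : Set} (c : V → V → Colour) L →
  cliques (λ u v → isEdge (c u v)) 2 L
    ≡ cliques (λ u v → isBlue (c u v)) 2 L ℕ.+ cliques (λ u v → isRed (c u v)) 2 L
edges-by-colour c [] = refl
edges-by-colour {V} c ((u , x) ∷ L) = trans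
  (cong₂ (λ e f → e ℕ.+ x ℕ.* f) (edges-by-colour c L) (degree L))
  (lemma (cliques (λ u v → isBlue (c u v)) 2 L) (cliques (λ u v → isRed (c u v)) 2 L) _ _ x)
  where
  lemma : ∀ e f g h x → e ℕ.+ f ℕ.+ x ℕ.* (g ℕ.+ h) ≡ e ℕ.+ x ℕ.* g ℕ.+ (f ℕ.+ x ℕ.* h)
  lemma = ℕ-Ring.solve-∀
  deg : (Colour → Bool) → Weighted → ℕ
  deg p L = cliques (λ u v → p (c u v)) 1 (nbrs (λ u v → p (c u v)) u L)
  degree : ∀ L → deg isEdge L ≡ deg isBlue L ℕ.+ deg isRed L
  degree [] = refl
  degree ((v , y) ∷ L) with c u v
  ... | none = degree L
  ... | blue = trans (cong (ℕ._+ y ℕ.* 1) (degree L)) (lemma₁ (deg isBlue L) (deg isRed L) y)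
    where
    lemma₁ : ∀ e f y → e ℕ.+ f ℕ.+ y ℕ.* 1 ≡ e ℕ.+ y ℕ.* 1 ℕ.+ f
    lemma₁ = ℕ-Ring.solve-∀
  ... | red  = trans (cong (ℕ._+ y ℕ.* 1) (degree L)) (ℕₚ.+-assoc (deg isBlue L) _ _)

-- Turán's theorem and the final bound

turan : ∀ m {n} (G : Graph n) → KFree (suc (suc m)) G → edgeCount G ≤ esym 2 (equiparts m n)
turan m {n} G free = subst (_≤ esym 2 T) (≡-sym (edgeCount-cliques (adj G) (λ i → i) G (λ _ _ → refl)))
  -- All edges are taken as blue, with 2-cliques and `t = 1`: the value reduces to the edge count
  -- and both alternatives to `esym 2 T`.
  (ℤₚ.drop‿+≤+ (conclude (coloured-bound-units (Graph.sym G) (Graph.sym G) (λ _ _ e → e) 0 0 m (λ i → i)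
    (trans (≡-sym (copiesK-cliques (adj G) (Graph.sym G) (λ i → i) G (λ _ _ → refl) (suc (suc m)))) free))))
  where
  T = equiparts m n
  E = cliques (adj G) 2 (units (λ i → i))
  simplify : ∀ e → e - + 1 * e + e ≡ e
  simplify = ℤ-Ring.solve-∀
  conclude : + E - + 1 * + E + + E ≤ℤ + esym 2 T ⊎ + E - + 1 * + E + + E ≤ℤ + esym 2 T - + 0 * + esym 2 T →
    + E ≤ℤ + esym 2 T
  conclude (inj₁ p) = subst (_≤ℤ + esym 2 T) (simplify (+ E)) p
  conclude (inj₂ p) = subst (_≤ℤ + esym 2 T) (simplify (+ E)) (ℤₚ.≤-trans p (ℤₚ.≤-reflexive (ℤₚ.+-identityʳ _)))

theorem5 : (r t k n : ℕ) → 2 ≤ r → 1 ≤ t → 2 ≤ k →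
    (exR exK : ℕ) → IsExCliques n r k exR → IsExEdges n k exK →
    (G : BRGraph n) → KFree k (underlying G) →
    + copiesK r (blueGraph G) + + t * + edgeCount (redGraph G)
    + (+ t - + 1) * (+ (n C 2) - + edgeCount (underlying G))
    ≤ℤ (+ t - + 1) * + (n C 2)
    + ((+ exR - (+ t - + 1) * + exK) ⊔ + exK)
theorem5 (suc (suc r)) (suc s) (suc (suc m)) n (s≤s (s≤s _)) _ (s≤s (s≤s _)) exR exK (maxR , _) (maxK , G₀ , free₀ , refl) G free =
  begin
    -- For `t = suc s` the factor `+ t - + 1` computes to `+ s`.
    + copiesK (suc (suc r)) (blueGraph G) + + suc s * + edgeCount (redGraph G)
      + + s * (+ (n C 2) - + edgeCount (underlying G))
      ≡⟨ cong₂ _+_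
           (cong₂ (λ x y → + x + + suc s * + y)
             (copiesK-cliques blue? blue?-sym id (blueGraph G) (λ _ _ → refl) (suc (suc r)))
             (edgeCount-cliques red? id (redGraph G) (λ _ _ → refl)))
           (cong (λ x → + s * (+ (n C 2) - + x)) (edgeCount-cliques edge? id (underlying G) (λ _ _ → refl))) ⟩
    + N + + suc s * + R + + s * (+ (n C 2) - + E)
      ≡⟨ cong (λ e → + N + + suc s * + R + + s * (+ (n C 2) - e)) E≡B+R ⟩
    + N + + suc s * + R + + s * (+ (n C 2) - (+ B + + R))
      -- Red edges are traded for blue ones: `t * R - (t - 1) * (B + R)` equals `(B + R) - t * B`.
      ≡⟨ rearrange (+ N) (+ R) (+ B) (+ s) (+ (n C 2)) ⟩
    + s * + (n C 2) + (+ N - + suc s * + B + (+ B + + R))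
      ≡⟨ cong (λ e → + s * + (n C 2) + (+ N - + suc s * + B + e)) (≡-sym E≡B+R) ⟩
    + s * + (n C 2) + (+ N - + suc s * + B + + E)
      ≤⟨ ℤₚ.+-monoʳ-≤ (+ s * + (n C 2)) (conclude (coloured-bound-units edge?-sym blue?-sym blue⊆edge r s m id
           (trans (≡-sym (copiesK-cliques edge? edge?-sym id (underlying G) (λ _ _ → refl) (suc (suc m)))) free))) ⟩
    + s * + (n C 2) + ((+ exR - + s * + exK) ⊔ + exK) ∎
  where
  open ℤₚ.≤-Reasoning
  id : Fin n → Fin n
  id i = i
  edge? blue? red? : Fin n → Fin n → Bool
  edge? i j = isEdge (col G i j)
  blue? i j = isBlue (col G i j)
  red?  i j = isRed (col G i j)
  edge?-sym : ∀ i j → edge? i j ≡ edge? j i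
  edge?-sym i j = cong isEdge (BRGraph.sym G i j)
  blue?-sym : ∀ i j → blue? i j ≡ blue? j i
  blue?-sym i j = cong isBlue (BRGraph.sym G i j)
  blue⊆edge : ∀ i j → edge? i j ≡ false → blue? i j ≡ false
  blue⊆edge i j e with col G i j
  ... | none = refl
  N = cliques blue? (suc (suc r)) (units id)
  B = cliques blue? 2 (units id)
  R = cliques red? 2 (units id)
  E = cliques edge? 2 (units id)
  T = equiparts m n

  E≡B+R : + E ≡ + B + + R
  E≡B+R = trans (cong (λ e → + e) (edges-by-colour (col G) (units id))) (ℤₚ.pos-+ B R)

  rearrange : ∀ N R B s C → N + (+ 1 + s) * R + s * (C - (B + R)) ≡ s * C + (N - (+ 1 + s) * B + (B + R))
  rearrange = ℤ-Ring.solve-∀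

  -- Any list of `m + 1` entries with sum `n` yields `parts` and `total`; here one part takes
  -- everything.
  open EquipartsOptimal (equiparts-optimal 0 0 (n ∷ replicate m 0)
    (cong suc (length-replicate m))
    (trans (cong (n ℕ.+_) (trans (sum-replicate m 0) (ℕₚ.*-zeroʳ m))) (ℕₚ.+-identityʳ n)))
    using (parts; total)

  turanGraph : Σ (Graph n) λ H → (∀ r → copiesK r H ≡ esym r T) × edgeCount H ≡ esym 2 T
  turanGraph = completeMultipartite T total

  H-free : KFree (suc (suc m)) (proj₁ turanGraph)
  H-free = trans (proj₁ (proj₂ turanGraph) _)
    (esym-vanishes (suc (suc m)) T (ℕₚ.≤-reflexive (cong suc parts)))

  T≤exK : esym 2 T ≤ exK
  T≤exK = subst (_≤ exK) (proj₂ (proj₂ turanGraph)) (maxK (proj₁ turanGraph) H-free)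

  T≤exR : esym (suc (suc r)) T ≤ exR
  T≤exR = subst (_≤ exR) (proj₁ (proj₂ turanGraph) (suc (suc r))) (maxR (proj₁ turanGraph) H-free)

  -- Since `exK` is subtracted, it needs an upper bound: Turán's theorem for the extremal graph
  -- `G₀`.
  gain≤ : gain r s T ≤ℤ + exR - + s * + exK
  gain≤ = ℤₚ.+-mono-≤ (ℤ.+≤+ T≤exR)
    (ℤₚ.neg-mono-≤ (ℤₚ.*-monoˡ-≤-nonNeg (+ s) (ℤ.+≤+ (turan m G₀ free₀))))

  conclude : ∀ {z} → z ≤ℤ + esym 2 T ⊎ z ≤ℤ gain r s T → z ≤ℤ (+ exR - + s * + exK) ⊔ + exK
  conclude (inj₁ p) = ℤₚ.≤-trans p (ℤₚ.≤-trans (ℤ.+≤+ T≤exK) (ℤₚ.i≤j⊔i (+ exR - + s * + exK) (+ exK)))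
  conclude (inj₂ p) = ℤₚ.≤-trans p (ℤₚ.≤-trans gain≤ (ℤₚ.i≤i⊔j (+ exR - + s * + exK) (+ exK)))
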